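{- Let $\phi>1$ be an integer. There exist a constant $\kappa>0$ and an infinite set $N$ of positive integers such that for every $n\in N$ there is a family $\mathcal{N}_n$ of $n$-node feasible graphs, each of election index $\phi$, with the following property: for every leader election algorithm with advice that performs leader election in time $\phi$ in all graphs of $\mathcal{N}_n$, some graph of $\mathcal{N}_n$ receives advice of length at least $\kappa\, n(\log\log n)^2/\log n$.
   Context: A graph is a simple undirected connected graph with $n\ge 3$ anonymous nodes; at each node of degree $d$ the incident edges carry distinct port numbers $0,\dots,d-1$ (local, unrelated at the two endpoints of an edge). The truncated view $\mathcal{V}^l(v)$ is defined inductively: $\mathcal{V}^0(v)$ is a single node; $\mathcal{V}^{l+1}(v)$ is the port-labeled tree rooted at $x_0$ having, for each neighbor $v_i$ of $v$, a child $x_i$ with the ports of edge $\{x_0,x_i\}$ equal to the ports of edge $\{v,v_i\}$ at $v$ and at $v_i$ respectively, and $x_i$ the root of a copy of $\mathcal{V}^l(v_i)$; the view is the infinite limit. The augmented truncated view $\mathcal{B}^l(v)$ is $\mathcal{V}^l(v)$ with leaves labeled by their degrees. A graph is feasible if all node views are distinct. Model: synchronous rounds (LOCAL), all nodes start simultaneously, each round each node exchanges arbitrary messages with all neighbors; initially a node knows only its degree and the advice, so after $r$ rounds its knowledge is the advice and $\mathcal{B}^r(v)$. Leader election: each node $v$ outputs $(p_1,q_1,\dots,p_k,q_k)$ such that the path from $v$ whose $i$-th edge has port $p_i$ at the endpoint nearer $v$ and $q_i$ at the other endpoint is a simple path, and all these paths end at a common node. Time = number of rounds until all nodes output. The election index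 of a feasible graph is the minimum time in which leader election is possible when nodes know the map of the graph (isomorphic copy with ports); equivalently, the smallest $\ell$ such that all $\mathcal{B}^\ell(v)$ are distinct. Advice: an oracle knowing the whole graph gives the same binary string to all nodes at the start; a leader election algorithm with advice consists of such an oracle and a deterministic distributed algorithm. Logarithms are base 2. -}

module Defs where

open import Data.Nat using (ℕ; zero; suc; _<_)
open import Data.Fin using (Fin; toℕ)
open import Data.List using (List; []; _∷_; map; allFin)
open import Data.List.Relation.Unary.Unique.Propositional using (Unique)
open import Data.Product using (_×_; _,_; Σ; ∃)
open import Relation.Binary.PropositionalEquality using (_≡_; _≢_)
open import Relation.Nullary using (¬_)

-- Anonymous port-labeled simple undirected graph on n nodes (nodes = Fin n,
-- only used by the oracle/analysis; the algorithm sees only views).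
-- At node v of degree deg v, port p : Fin (deg v) leads to nbr v p, and the
-- port of the same edge at the other endpoint is bport v p.
record PortGraph (n : ℕ) : Set where
  field
    deg   : Fin n → ℕ
    nbr   : (v : Fin n) → Fin (deg v) → Fin n
    bport : (v : Fin n) (p : Fin (deg v)) → Fin (deg (nbr v p))
    back-nbr  : ∀ v p → nbr (nbr v p) (bport v p) ≡ v
    back-port : ∀ v p → toℕ (bport (nbr v p) (bport v p)) ≡ toℕ p
    no-loop   : ∀ v p → nbr v p ≢ v
    no-multi  : ∀ v p p′ → nbr v p ≡ nbr v p′ → p ≡ p′

open PortGraph public

module _ {n : ℕ} (G : PortGraph n) where

  data Reachable : Fin n → Fin n → Set where
    refl-r : ∀ {v} → Reachable v v
    step-r : ∀ {v w} (p : Fin (deg G v)) → Reachable (nbr G v p) w → Reachable v w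

Connected : ∀ {n} → PortGraph n → Set
Connected {n} G = (u w : Fin n) → Reachable G u w

-- Port-labeled rooted trees (views).  A child entry (q , t) at position p of
-- the children list means: edge with port p at the parent, port q at the child,
-- child subtree t.
data Tree : Set where
  bare : Tree                    -- unlabeled leaf (truncated view 𝒱)
  leaf : ℕ → Tree                -- leaf labeled by its degree (augmented view ℬ)
  node : List (ℕ × Tree) → Tree

module _ {n : ℕ} (G : PortGraph n) where

  V : ℕ → Fin n → Tree
  V zero    v = bare
  V (suc l) v = node (map (λ p → toℕ (bport G v p) , V l (nbr G v p)) (allFin (deg G v)))

  B : ℕ → Fin n → Tree
  B zero    v = leaf (deg G v)
  B (suc l) v = node (map (λ p → toℕ (bport G v p) , B l (nbr G v p)) (allFin (deg G v)))

  -- equality of (infinite) views = equality of all truncations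
  SameView : Fin n → Fin n → Set
  SameView u v = (l : ℕ) → V l u ≡ V l v

  Feasible : Set
  Feasible = (u v : Fin n) → SameView u v → u ≡ v

  DistinctB : ℕ → Set
  DistinctB l = (u v : Fin n) → B l u ≡ B l v → u ≡ v

  ElectionIndex : ℕ → Set
  ElectionIndex φ = DistinctB φ × ((l : ℕ) → l < φ → ¬ DistinctB l)

  data PathFrom : Fin n → List (ℕ × ℕ) → List (Fin n) → Fin n → Set where
    here : ∀ {v} → PathFrom v [] (v ∷ []) v
    step : ∀ {v w ps ws} (p : Fin (deg G v)) →
           PathFrom (nbr G v p) ps ws w →
           PathFrom v ((toℕ p , toℕ (bport G v p)) ∷ ps) (v ∷ ws) w

  Elects : (Fin n → List (ℕ × ℕ)) → Set
  Elects out = ∃ λ w → (v : Fin n) → ∃ λ ws → PathFrom v (out v) ws w × Unique ws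

{-# OPTIONS --safe #-}
-- The graphs are necklaces: a path of K = mᵐ hubs, each carrying a complete
-- bipartite gadget with O(m) vertices, prolonged at both ends by a tail of φ
-- vertices.  In the i-th gadget the ports leading back to the hub spell the m
-- digits of i in base m, so that the gadget is identified within distance 2 of
-- each of its vertices.  The bridge between hubs i and i + 1 enters hub i + 1
-- at a port chosen among m by a code; there are m^(K - 1) codes.
--
-- The two tail ends have the same view at depth φ - 1, and their views at depth
-- φ do not depend on the code.  Hence with equal advice they output the same
-- port sequences in two necklaces.  A walk with given port sequence from the
-- left end runs identically in both necklaces up to the first bridge on which
-- the codes differ, and it cannot cross that bridge.  Following the left end's
-- path to the leader and then the right end's path backwards would cross it,
-- so distinct codes need distinct advice, that is, (K - 1) log m bits.
module Submission where

open import Defs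
open import Data.Nat
open import Data.Nat.Properties
open import Data.Nat.Logarithm using (⌊log₂_⌋; ⌊log₂⌋-mono-≤; ⌊log₂[2^n]⌋≡n)
open import Data.Nat.Tactic.RingSolver using (solve-∀)
open import Data.Nat.Binary using (ℕᵇ; 2[1+_]; 1+[2_])
import Data.Nat.Binary as ℕᵇ
import Data.Nat.Binary.Properties as ℕᵇ
open import Data.Bool using (Bool; true; false)
open import Data.Fin using (Fin; zero; suc; toℕ; fromℕ; fromℕ<; inject₁; splitAt; _↑ˡ_; _↑ʳ_; cast; combine; finToFun; funToFin)
import Data.Fin as Fin
import Data.Fin.Properties as Fin
open import Data.Fin.Properties using (toℕ-injective; toℕ-inject₁; toℕ-fromℕ; toℕ<n; splitAt-↑ˡ; splitAt-↑ʳ; +↔⊎; *↔×; 2↔Bool)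
import Data.Fin.Induction as Fin
open import Data.Fin.Relation.Unary.Top using (View; view; ‵fromℕ; ‵inject₁; view-fromℕ; view-inject₁)
open import Data.List using (List; []; _∷_; _++_; map; allFin; length; tabulate)
open import Data.List.Properties using (map-cong; length-map; length-tabulate; ∷-injective)
open import Data.List.Relation.Unary.All using (All)
import Data.List.Relation.Unary.All as All
import Data.List.Relation.Unary.All.Properties as All
open import Data.List.Relation.Unary.Any using (Any; any?)
open import Data.List.Membership.Propositional using (_∈_; lose)
open import Data.List.Membership.Propositional.Properties using (∈-map⁺; ∈-allFin)
open import Data.Product using (_×_; _,_; Σ; ∃; ∃₂; proj₁; proj₂; swap)
open import Data.Sum using (_⊎_; inj₁; inj₂; [_,_]′)
open import Data.Sum.Function.Propositional using (_⊎-↔_)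
open import Data.Empty using (⊥)
open import Data.Unit using (⊤; tt)
open import Function using (_∘_; id; const; Inverse; _↔_)
open import Function.Bundles using (mk↔ₛ′)
open import Function.Construct.Composition using (_↔-∘_)
import Induction.WellFounded as WellFounded
open import Relation.Nullary using (Dec; yes; no; contradiction)
open import Relation.Binary.PropositionalEquality
open import Relation.Binary.Construct.Closure.ReflexiveTransitive using (Star; ε; _◅_; _◅◅_; gmap; reverse)

-- Port-labelled networks on arbitrary vertex sets

-- With the edges given as an involution on darts, one equation between darts replaces the two
-- back-edge laws of `PortGraph`, and an arbitrary vertex type allows case analysis on vertices.
record Network (N : Set) : Set where
  field
    degree : N → ℕ

  Dart : Set
  Dart = Σ N (Fin ∘ degree)

  field
    opp            : Dart → Dart
    opp-involutive : ∀ d → opp (opp d) ≡ d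
    loopless       : ∀ d → proj₁ (opp d) ≢ proj₁ d
    simple         : ∀ v p p′ → proj₁ (opp (v , p)) ≡ proj₁ (opp (v , p′)) → p ≡ p′

  portℕ : Dart → ℕ
  portℕ (_ , p) = toℕ p

  view-of : ℕ → N → Tree
  branch  : ℕ → Dart → ℕ × Tree
  view-of zero    v = leaf (degree v)
  view-of (suc l) v = node (map (λ p → branch l (opp (v , p))) (allFin (degree v)))
  branch l (w , q) = toℕ q , view-of l w

  Adjacent : N → N → Set
  Adjacent v w = ∃ λ p → proj₁ (opp (v , p)) ≡ w

  Adjacent-sym : ∀ {v w} → Adjacent v w → Adjacent w v
  Adjacent-sym {v} (p , refl) = proj₂ (opp (v , p)) , cong proj₁ (opp-involutive (v , p))

  data Walk : N → List (ℕ × ℕ) → N → Set where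
    stop : ∀ {v} → Walk v [] v
    go   : ∀ {v w ps} (p : Fin (degree v)) → Walk (proj₁ (opp (v , p))) ps w →
           Walk v ((toℕ p , portℕ (opp (v , p))) ∷ ps) w

  snoc : ∀ {v u ps} → Walk v ps u → (p : Fin (degree u)) →
         Walk v (ps ++ (toℕ p , portℕ (opp (u , p))) ∷ []) (proj₁ (opp (u , p)))
  snoc stop     p = go p stop
  snoc (go q W) p = go q (snoc W p)

-- The reversal is computed from the port sequence alone, so equal outputs in two necklaces have
-- equal reversals.
back : List (ℕ × ℕ) → List (ℕ × ℕ)
back []             = []
back ((p , q) ∷ ps) = back ps ++ (q , p) ∷ []

module _ {N : Set} (X : Network N) where
  open Network X

  back-walk : ∀ {v w ps} → Walk v ps w → Walk w (back ps) v
  back-walk stop                   = stop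
  back-walk {v} {w} (go {ps = ps} p W) =
    subst₂ (λ q u → Walk w (back ps ++ (portℕ (opp (v , p)) , q) ∷ []) u)
      (cong portℕ (opp-involutive (v , p))) (cong proj₁ (opp-involutive (v , p)))
      (snoc (back-walk W) (proj₂ (opp (v , p))))

-- Positions are compared through `toℕ`, as `Fin a` and `Fin b` are different types until the
-- lengths are known to agree.
map-allFin-injective : ∀ {A : Set} {a b} {f : Fin a → A} {g : Fin b → A} →
  map f (allFin a) ≡ map g (allFin b) → a ≡ b × (∀ p p′ → toℕ p ≡ toℕ p′ → f p ≡ g p′)
map-allFin-injective {A} {f = f} {g} e = go (trans (sym (length-map-allFin f)) (trans (cong length e) (length-map-allFin g))) e
  where
  length-map-allFin : ∀ {n} (f : Fin n → A) → length (map f (allFin n)) ≡ n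
  length-map-allFin f = trans (length-map f (allFin _)) (length-tabulate id)

  pointwise : ∀ {m n} {f g : Fin n → A} (h : Fin m → Fin n) →
    map f (tabulate h) ≡ map g (tabulate h) → ∀ p → f (h p) ≡ g (h p)
  pointwise h e zero    = proj₁ (∷-injective e)
  pointwise h e (suc p) = pointwise (h ∘ suc) (proj₂ (∷-injective e)) p

  go : ∀ {a b} {f : Fin a → A} {g : Fin b → A} → a ≡ b → map f (allFin a) ≡ map g (allFin b) →
    a ≡ b × (∀ p p′ → toℕ p ≡ toℕ p′ → f p ≡ g p′)
  go {f = f} {g} refl e = refl , λ p p′ p≡p′ → subst (λ q → f p ≡ g q) (toℕ-injective p≡p′) (pointwise id e p)

node-injective : ∀ {ts us : List (ℕ × Tree)} → node ts ≡ node us → ts ≡ us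
node-injective refl = refl

leaf-injective : ∀ {a b} → leaf a ≡ leaf b → a ≡ b
leaf-injective refl = refl

module _ {N : Set} (X : Network N) where
  open Network X

  view-degree : ∀ l u v → view-of l u ≡ view-of l v → degree u ≡ degree v
  view-degree zero    u v e = leaf-injective e
  view-degree (suc l) u v e = proj₁ (map-allFin-injective (node-injective e))

  view-step : ∀ l u v → view-of (suc l) u ≡ view-of (suc l) v → ∀ p p′ → toℕ p ≡ toℕ p′ →
    portℕ (opp (u , p)) ≡ portℕ (opp (v , p′)) ×
    view-of l (proj₁ (opp (u , p))) ≡ view-of l (proj₁ (opp (v , p′)))
  view-step l u v e p p′ p≡p′ = cong proj₁ e′ , cong proj₂ e′
    where e′ = proj₂ (map-allFin-injective (node-injective e)) p p′ p≡p′

  -- Conjugating `opp` by an involutive permutation of ports yields an involution again and leaves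
  -- the underlying graph unchanged.
  module Relabel (σ : ∀ v → Fin (degree v) → Fin (degree v)) (σ-involutive : ∀ v p → σ v (σ v p) ≡ p) where

    act : Dart → Dart
    act (v , p) = v , σ v p

    act-involutive : ∀ d → act (act d) ≡ d
    act-involutive (v , p) = cong (v ,_) (σ-involutive v p)

    relabel : Network N
    relabel = record
      { degree         = degree
      ; opp            = act ∘ opp ∘ act
      ; opp-involutive = λ d → trans (cong (act ∘ opp) (act-involutive (opp (act d))))
                          (trans (cong act (opp-involutive (act d))) (act-involutive d))
      ; loopless       = λ d → loopless (act d)
      ; simple         = λ v p p′ e → trans (sym (σ-involutive v p))
                          (trans (cong (σ v) (simple v _ _ e)) (σ-involutive v p′))
      }

    relabel-adjacent : ∀ {v w} → Adjacent v w → Network.Adjacent relabel v w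
    relabel-adjacent {v} (p , e) = σ v p , trans (cong (proj₁ ∘ opp ∘ (v ,_)) (σ-involutive v p)) e

-- From networks to port-labelled graphs on `Fin n`

module _ {N : Set} {n : ℕ} (iso : Fin n ↔ N) (X : Network N) where
  open Network X
  open Inverse iso using (to; from; strictlyInverseˡ; strictlyInverseʳ)

  private
    transport : ∀ {w w′} (e : w ≡ w′) (q : Fin (degree w)) → _≡_ {A = Dart} (w′ , subst (Fin ∘ degree) e q) (w , q)
    transport refl q = refl

  next : (v : Fin n) → Fin (degree (to v)) → Fin n
  next v p = from (proj₁ (opp (to v , p)))

  next-port : (v : Fin n) (p : Fin (degree (to v))) → Fin (degree (to (next v p)))
  next-port v p = subst (Fin ∘ degree) (sym (strictlyInverseˡ _)) (proj₂ (opp (to v , p)))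

  next-dart : ∀ v p → _≡_ {A = Dart} (to (next v p) , next-port v p) (opp (to v , p))
  next-dart v p = transport (sym (strictlyInverseˡ _)) _

  next-next : ∀ v p → opp (to (next v p) , next-port v p) ≡ (to v , p)
  next-next v p = trans (cong opp (next-dart v p)) (opp-involutive _)

  to-injective : ∀ {u v} → to u ≡ to v → u ≡ v
  to-injective {u} {v} e = trans (sym (strictlyInverseʳ u)) (trans (cong from e) (strictlyInverseʳ v))

  from-injective : ∀ {u v} → from u ≡ from v → u ≡ v
  from-injective {u} {v} e = trans (sym (strictlyInverseˡ u)) (trans (cong to e) (strictlyInverseˡ v))

  portGraph : PortGraph n
  portGraph = record
    { deg       = degree ∘ to
    ; nbr       = next
    ; bport     = next-port
    ; back-nbr  = λ v p → trans (cong (from ∘ proj₁) (next-next v p)) (strictlyInverseʳ v)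
    ; back-port = λ v p → trans (cong portℕ (next-dart (next v p) (next-port v p))) (cong portℕ (next-next v p))
    ; no-loop   = λ v p e → loopless (to v , p) (trans (sym (strictlyInverseˡ _)) (cong to e))
    ; no-multi  = λ v p p′ e → simple (to v) p p′ (from-injective e)
    }

  B-view : ∀ l v → B portGraph l v ≡ view-of l (to v)
  B-view zero    v = refl
  B-view (suc l) v = cong node (map-cong (λ p →
    trans (cong (toℕ (next-port v p) ,_) (B-view l (next v p))) (cong (branch l) (next-dart v p)))
    (allFin (degree (to v))))

  path-walk : ∀ {v ps ws w} → PathFrom portGraph v ps ws w → Walk (to v) ps (to w)
  path-walk here               = stop
  path-walk {v} {w = w} (step {ps = ps} p P) =
    subst (λ q → Walk (to v) ((toℕ p , q) ∷ ps) (to w)) (sym (cong portℕ (next-dart v p)))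
      (go p (subst (λ u → Walk u ps (to w)) (cong proj₁ (next-dart v p)) (path-walk P)))

  star-reachable : ∀ {u v} → Star Adjacent (to u) (to v) → Reachable portGraph u v
  star-reachable s = subst₂ (Reachable portGraph) (strictlyInverseʳ _) (strictlyInverseʳ _) (reach s)
    where
    reach : ∀ {x y} → Star Adjacent x y → Reachable portGraph (from x) (from y)
    reach ε                        = refl-r
    reach {x} {y} ((p , refl) ◅ s) = cross (strictlyInverseˡ x) p s
      where
      cross : ∀ {x} → to (from x) ≡ x → (p : Fin (degree x)) →
        Star Adjacent (proj₁ (opp (x , p))) y → Reachable portGraph (from x) (from y)
      cross {x} e p s = step-r p′ (subst (λ d → Reachable portGraph (from (proj₁ (opp d))) (from y)) (sym (transport (sym e) p)) (reach s))
        where p′ = subst (Fin ∘ degree) (sym e) p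

-- Plain views against augmented views

V-degree : ∀ {n} (G : PortGraph n) l {u v} → V G (suc l) u ≡ V G (suc l) v → deg G u ≡ deg G v
V-degree G l e = proj₁ (map-allFin-injective (node-injective e))

-- The ports seen at depth l + 1 reveal the degrees at depth l.
V⇒B : ∀ {n} (G : PortGraph n) l u v → V G (suc l) u ≡ V G (suc l) v → B G l u ≡ B G l v
V⇒B G zero    u v e = cong leaf (V-degree G 0 e)
V⇒B G (suc l) u v e = cong node (lift (map-allFin-injective (node-injective e)))
  where
  lift : ∀ {a b} {f : Fin a → Fin _} {g : Fin b → Fin _} {x : Fin a → ℕ} {y : Fin b → ℕ} →
    a ≡ b × (∀ p p′ → toℕ p ≡ toℕ p′ → (x p , V G (suc l) (f p)) ≡ (y p′ , V G (suc l) (g p′))) →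
    map (λ p → x p , B G l (f p)) (allFin a) ≡ map (λ p → y p , B G l (g p)) (allFin b)
  lift (refl , h) = map-cong (λ p → cong₂ _,_ (cong proj₁ (h p p refl))
    (V⇒B G l _ _ (cong proj₂ (h p p refl)))) (allFin _)

feasible : ∀ {n} (G : PortGraph n) l → DistinctB G l → Feasible G
feasible G l d u v s = d u v (V⇒B G l u v (s (suc l)))

-- The skeleton of the necklaces

inject₁≢suc : ∀ {n} (i : Fin n) → inject₁ i ≢ suc i
inject₁≢suc i e = 1+n≢n (trans (cong toℕ (sym e)) (toℕ-inject₁ i))

inject₁≡suc-asym : ∀ {n} {i : Fin n} {j : Fin n} → inject₁ i ≡ suc j → inject₁ j ≢ suc i
inject₁≡suc-asym {i = i} {j} e e′ = <-irrefl (trans (sym (toℕ-inject₁ j)) (cong toℕ e′))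
  (s≤s (≤-trans (n≤1+n _) (≤-reflexive (trans (cong toℕ (sym e)) (toℕ-inject₁ i)))))

-- There are two tails of length f + 1 and k + 1 gadgets; besides the hub, the
-- two sides of a gadget have m and r vertices.
module Skeleton (f k m r : ℕ) where

  data Node : Set where
    tail : Bool → Fin (suc f) → Node
    hub  : Fin (suc k) → Node
    low  : Fin (suc k) → Fin m → Node
    high : Fin (suc k) → Fin r → Node

  order : ℕ
  order = 2 * suc f + suc k * (1 + (m + r))

  node↔ : Fin order ↔ Node
  node↔ = mk↔ₛ′ to from to-from from-to ↔-∘ ((*↔× ⊎-↔ *↔×) ↔-∘ +↔⊎)
    where
    Position : Set
    Position = (Fin 2 × Fin (suc f)) ⊎ (Fin (suc k) × Fin (1 + (m + r)))
    open Inverse (+↔⊎ {m} {r}) using () renaming (to to side; from to unside; strictlyInverseˡ to side-unside; strictlyInverseʳ to unside-side)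
    open Inverse 2↔Bool using () renaming (to to bool; from to unbool; strictlyInverseˡ to bool-unbool; strictlyInverseʳ to unbool-bool)
    to : Position → Node
    to (inj₁ (s , j))     = tail (bool s) j
    to (inj₂ (i , zero))  = hub i
    to (inj₂ (i , suc p)) with side p
    ... | inj₁ a = low i a
    ... | inj₂ b = high i b
    from : Node → Position
    from (tail s j) = inj₁ (unbool s , j)
    from (hub i)    = inj₂ (i , zero)
    from (low i a)  = inj₂ (i , suc (unside (inj₁ a)))
    from (high i b) = inj₂ (i , suc (unside (inj₂ b)))
    to-from : ∀ v → to (from v) ≡ v
    to-from (tail s j) = cong (λ t → tail t j) (bool-unbool s)
    to-from (hub i)    = refl
    to-from (low i a)  rewrite side-unside (inj₁ a) = refl
    to-from (high i b) rewrite side-unside (inj₂ b) = refl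
    from-to : ∀ x → from (to x) ≡ x
    from-to (inj₁ (s , j))     = cong (λ t → inj₁ (t , j)) (unbool-bool s)
    from-to (inj₂ (i , zero))  = refl
    from-to (inj₂ (i , suc p)) with side p in eq
    ... | inj₁ a = cong (λ q → inj₂ (i , suc q)) (trans (cong unside (sym eq)) (unside-side p))
    ... | inj₂ b = cong (λ q → inj₂ (i , suc q)) (trans (cong unside (sym eq)) (unside-side p))

  -- Position zero of a tail is its free end; port 0 leads towards the hubs.
  outward : Fin (suc f) → ℕ
  outward zero    = 0
  outward (suc _) = 1

  valency : Node → ℕ
  valency (tail s j) = suc (outward j)
  valency (hub i)    = 2 + r
  valency (low i a)  = r
  valency (high i p) = suc m

  Port : Set
  Port = Σ Node (Fin ∘ valency)

  -- The tails stand in for the missing bridges at the two end hubs, so that all hubs have the same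
  -- valency. The ports 0 and 1 used here are what tells the two tails apart.
  attachment : Bool → Port
  attachment false = hub zero , zero
  attachment true  = hub (fromℕ k) , suc zero

  -- Taking the view of `j` as an argument lets proofs match on it, and lets `view-fromℕ` and
  -- `view-inject₁` act by congruence.
  inward : Bool → {j : Fin (suc f)} → View j → Port
  inward s ‵fromℕ       = attachment s
  inward s (‵inject₁ j) = tail s (suc j) , suc zero

  leftward : Fin (suc k) → Port
  leftward zero    = tail false (fromℕ f) , zero
  leftward (suc i) = hub (inject₁ i) , suc zero

  rightward : ∀ {i : Fin (suc k)} → View i → Port
  rightward ‵fromℕ      = tail true (fromℕ f) , zero
  rightward (‵inject₁ i) = hub (suc i) , zero

  opposite : Port → Port
  opposite (tail s j       , zero)        = inward s (view j)
  opposite (tail s (suc j) , suc zero)    = tail s (inject₁ j) , zero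
  opposite (hub i          , zero)        = leftward i
  opposite (hub i          , suc zero)    = rightward (view i)
  opposite (hub i          , suc (suc p)) = high i p , zero
  opposite (low i a        , p)           = high i p , suc a
  opposite (high i p       , zero)        = hub i , suc (suc p)
  opposite (high i p       , suc a)       = low i a , p

  opposite-inward : ∀ s {j : Fin (suc f)} (v : View j) → opposite (inward s v) ≡ (tail s j , zero)
  opposite-inward false ‵fromℕ       = refl
  opposite-inward true  ‵fromℕ       = cong (λ v → rightward v) (view-fromℕ k)
  opposite-inward s     (‵inject₁ j) = refl

  opposite-leftward : ∀ i → opposite (leftward i) ≡ (hub i , zero)
  opposite-leftward zero    = cong (λ v → inward false v) (view-fromℕ f)
  opposite-leftward (suc i) = cong (λ v → rightward v) (view-inject₁ i)

  opposite-rightward : ∀ {i : Fin (suc k)} (v : View i) → opposite (rightward v) ≡ (hub i , suc zero)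
  opposite-rightward ‵fromℕ       = cong (λ v → inward true v) (view-fromℕ f)
  opposite-rightward (‵inject₁ i) = refl

  opposite-involutive : ∀ d → opposite (opposite d) ≡ d
  opposite-involutive (tail s j           , zero)        = opposite-inward s (view j)
  opposite-involutive (tail s (suc j)     , suc zero)    = cong (λ v → inward s v) (view-inject₁ j)
  opposite-involutive (hub i              , zero)        = opposite-leftward i
  opposite-involutive (hub i              , suc zero)    = opposite-rightward (view i)
  opposite-involutive (hub i              , suc (suc p)) = refl
  opposite-involutive (low i a            , p)           = refl
  opposite-involutive (high i p           , zero)        = refl
  opposite-involutive (high i p           , suc a)       = refl

  tail-injective : ∀ {s t i j} → tail s i ≡ tail t j → i ≡ j
  tail-injective refl = refl

  hub-injective : ∀ {i j} → hub i ≡ hub j → i ≡ j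
  hub-injective refl = refl

  inward-loopless : ∀ s {j : Fin (suc f)} (v : View j) → proj₁ (inward s v) ≢ tail s j
  inward-loopless false ‵fromℕ ()
  inward-loopless true  ‵fromℕ ()
  inward-loopless s     (‵inject₁ j) e = inject₁≢suc j (sym (tail-injective e))

  opposite-loopless : ∀ d → proj₁ (opposite d) ≢ proj₁ d
  opposite-loopless (tail s j       , zero)         = inward-loopless s (view j)
  opposite-loopless (tail s (suc j) , suc zero) e   = inject₁≢suc j (tail-injective e)
  opposite-loopless (hub zero       , zero)         ()
  opposite-loopless (hub (suc i)    , zero)     e   = inject₁≢suc i (hub-injective e)
  opposite-loopless (hub i          , suc zero)     with view i
  ... | ‵fromℕ     = λ ()
  ... | ‵inject₁ j = λ e → inject₁≢suc j (sym (hub-injective e))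
  opposite-loopless (hub i          , suc (suc p)) ()
  opposite-loopless (low i a        , p)           ()
  opposite-loopless (high i p       , zero)        ()
  opposite-loopless (high i p       , suc a)       ()

  -- The index `j` stays a variable with an equation, because `inject₁ l` does not unify with
  -- `suc j′`.
  inward≢outward : ∀ s {j : Fin (suc f)} (v : View j) j′ → j ≡ suc j′ → proj₁ (inward s v) ≢ tail s (inject₁ j′)
  inward≢outward false ‵fromℕ j′ e ()
  inward≢outward true  ‵fromℕ j′ e ()
  inward≢outward s     (‵inject₁ l) j′ e e′ = inject₁≡suc-asym e (sym (tail-injective e′))

  leftward≢rightward : ∀ i {i′ : Fin (suc k)} (v : View i′) → i′ ≡ i → proj₁ (leftward i) ≢ proj₁ (rightward v)
  leftward≢rightward zero    ‵fromℕ       e ()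
  leftward≢rightward zero    (‵inject₁ l) e ()
  leftward≢rightward (suc i) ‵fromℕ       e ()
  leftward≢rightward (suc i) (‵inject₁ l) e e′ = inject₁≡suc-asym e (hub-injective e′)

  leftward≢high : ∀ i {j p} → proj₁ (leftward i) ≢ high j p
  leftward≢high zero ()
  leftward≢high (suc i) ()

  rightward≢high : ∀ {i : Fin (suc k)} {j p} (v : View i) → proj₁ (rightward v) ≢ high j p
  rightward≢high ‵fromℕ ()
  rightward≢high (‵inject₁ _) ()

  opposite-simple : ∀ v p p′ → proj₁ (opposite (v , p)) ≡ proj₁ (opposite (v , p′)) → p ≡ p′
  opposite-simple (tail s j) zero zero e = refl
  opposite-simple (tail s (suc j)) zero (suc zero) e = contradiction e (inward≢outward s (view (suc j)) j refl)
  opposite-simple (tail s (suc j)) (suc zero) zero e = contradiction (sym e) (inward≢outward s (view (suc j)) j refl)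
  opposite-simple (tail s (suc j)) (suc zero) (suc zero) e = refl
  opposite-simple (hub i) zero zero e = refl
  opposite-simple (hub i) zero (suc zero) e = contradiction e (leftward≢rightward i (view i) refl)
  opposite-simple (hub i) zero (suc (suc p)) e = contradiction e (leftward≢high i)
  opposite-simple (hub i) (suc zero) zero e = contradiction (sym e) (leftward≢rightward i (view i) refl)
  opposite-simple (hub i) (suc zero) (suc zero) e = refl
  opposite-simple (hub i) (suc zero) (suc (suc p)) e = contradiction e (rightward≢high (view i))
  opposite-simple (hub i) (suc (suc p)) zero e = contradiction (sym e) (leftward≢high i)
  opposite-simple (hub i) (suc (suc p)) (suc zero) e = contradiction (sym e) (rightward≢high (view i))
  opposite-simple (hub i) (suc (suc p)) (suc (suc .p)) refl = refl
  opposite-simple (low i a) p .p refl = refl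
  opposite-simple (high i p) zero zero e = refl
  opposite-simple (high i p) (suc a) (suc .a) refl = refl

  skeleton : Network Node
  skeleton = record
    { degree = valency ; opp = opposite ; opp-involutive = opposite-involutive
    ; loopless = opposite-loopless ; simple = opposite-simple }

  open Network skeleton using (Adjacent)

  hub-to-hub₀ : ∀ i → Star Adjacent (hub i) (hub zero)
  hub-to-hub₀ = Fin.<-weakInduction _ ε (λ i s → (zero , refl) ◅ s)

  tail-to-hub₀ : ∀ s j → Star Adjacent (tail s j) (hub zero)
  tail-to-hub₀ s = Fin.>-weakInduction _ (last s) (λ j r → (zero , inner s j) ◅ r)
    where
    last : ∀ s → Star Adjacent (tail s (fromℕ f)) (hub zero)
    last false = (zero , cong (λ v → proj₁ (inward false v)) (view-fromℕ f)) ◅ ε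
    last true  = (zero , cong (λ v → proj₁ (inward true v)) (view-fromℕ f)) ◅ hub-to-hub₀ (fromℕ k)
    inner : ∀ s j → proj₁ (inward s (view (inject₁ j))) ≡ tail s (suc j)
    inner s j = cong (λ v → proj₁ (inward s v)) (view-inject₁ j)

  -- A low vertex reaches its hub only through a high vertex, so one has to exist.
  module _ (p₀ : Fin r) where
    to-hub₀ : ∀ v → Star Adjacent v (hub zero)
    to-hub₀ (tail s j) = tail-to-hub₀ s j
    to-hub₀ (hub i)    = hub-to-hub₀ i
    to-hub₀ (low i a)  = (p₀ , refl) ◅ (zero , refl) ◅ hub-to-hub₀ i
    to-hub₀ (high i p) = (zero , refl) ◅ hub-to-hub₀ i

    connected : ∀ u v → Star Adjacent u v
    connected u v = to-hub₀ u ◅◅ reverse (Network.Adjacent-sym skeleton) (to-hub₀ v)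

-- Necklaces

-- The transposition of `zero` and `suc a`: it moves the edge at port 0, a bridge or the edge from a
-- high vertex to its hub, to a chosen port.
swap₀ : ∀ {n} → Fin n → Fin (suc n) → Fin (suc n)
swap₀ a zero    = suc a
swap₀ a (suc b) with b Fin.≟ a
... | yes _ = zero
... | no  _ = suc b

swap₀-gate : ∀ {n} (a : Fin n) → swap₀ a (suc a) ≡ zero
swap₀-gate a with a Fin.≟ a
... | yes _   = refl
... | no a≢a = contradiction refl a≢a

swap₀-other : ∀ {n} {a b : Fin n} → b ≢ a → swap₀ a (suc b) ≡ suc b
swap₀-other {a = a} {b} b≢a with b Fin.≟ a
... | yes b≡a = contradiction b≡a b≢a
... | no  _   = refl

swap₀-involutive : ∀ {n} (a : Fin n) p → swap₀ a (swap₀ a p) ≡ p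
swap₀-involutive a zero = swap₀-gate a
swap₀-involutive a (suc b) with b Fin.≟ a
... | yes refl = refl
... | no b≢a   = swap₀-other b≢a

swap₀-injective : ∀ {n} (a : Fin n) {p q} → swap₀ a p ≡ swap₀ a q → p ≡ q
swap₀-injective a {p} {q} e = trans (sym (swap₀-involutive a p)) (trans (cong (swap₀ a) e) (swap₀-involutive a q))

↑ʳ≢↑ˡ : ∀ {m n} (a : Fin m) (b : Fin n) → m ↑ʳ b ≢ a ↑ˡ n
↑ʳ≢↑ˡ {m} {n} a b e with trans (sym (splitAt-↑ʳ m n b)) (trans (cong (splitAt m) e) (splitAt-↑ˡ m a n))
... | ()

-- The election index φ is ψ + 2 = `suc f`, which is also the number of vertices of a tail. The word
-- `h i` plays the role of the digits of `i`.
module Necklace (ψ k m : ℕ) (1<m : 1 < m) (z : Fin m) (h : Fin (suc k) → Fin m → Fin m)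
                (h-injective : ∀ i i′ → (∀ d → h i d ≡ h i′ d) → i ≡ i′) where

  f : ℕ
  f = suc ψ

  open Skeleton f k m (m + m) public

  -- The first m high vertices share the label z, which lets the low vertices be
  -- told apart; the code uses the hub ports of these vertices only, so that the
  -- digits of i, spelt by the other m, stay at fixed ports of the hub.
  label : Fin (suc k) → Fin (m + m) → Fin m
  label i p = [ const z , h i ]′ (splitAt m p)

  label-anchor : ∀ i → label i (z ↑ˡ m) ≡ z
  label-anchor i rewrite splitAt-↑ˡ m z m = refl

  label-digit : ∀ i d → label i (m ↑ʳ d) ≡ h i d
  label-digit i d rewrite splitAt-↑ʳ m m d = refl

  Code : Set
  Code = Fin k → Fin m

  -- The code moves the bridge from hub `i` to port `c i` + 2 of hub `i` + 1. Independently of the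
  -- code, each high vertex has its edge to the hub moved to its label plus one.
  σ : Code → (v : Node) → Fin (valency v) → Fin (valency v)
  σ c (tail s j)    p = p
  σ c (hub zero)    p = p
  σ c (hub (suc i)) p = swap₀ (suc (c i ↑ˡ m)) p
  σ c (low i a)     p = p
  σ c (high i b)    p = swap₀ (label i b) p

  σ-involutive : ∀ c v p → σ c v (σ c v p) ≡ p
  σ-involutive c (tail s j)    p = refl
  σ-involutive c (hub zero)    p = refl
  σ-involutive c (hub (suc i)) p = swap₀-involutive _ p
  σ-involutive c (low i a)     p = refl
  σ-involutive c (high i b)    p = swap₀-involutive _ p

  σ-injective : ∀ c v {p q} → σ c v p ≡ σ c v q → p ≡ q
  σ-injective c v {p} {q} e = trans (sym (σ-involutive c v p)) (trans (cong (σ c v) e) (σ-involutive c v q))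

  σ-right : ∀ c i → σ c (hub i) (suc zero) ≡ suc zero
  σ-right c zero    = refl
  σ-right c (suc i) = refl

  σ-digit : ∀ c i d → σ c (hub i) (suc (suc (m ↑ʳ d))) ≡ suc (suc (m ↑ʳ d))
  σ-digit c zero    d = refl
  σ-digit c (suc i) d = swap₀-other λ e → ↑ʳ≢↑ˡ (c i) d (Fin.suc-injective e)

  module _ (c : Code) where
    open Relabel skeleton (σ c) (σ-involutive c) public using () renaming (act to twist; relabel to necklace; relabel-adjacent to necklace-adjacent)

  -- Distinguishing the vertices of a necklace

  data SameKind : Node → Node → Set where
    tails : ∀ {s t i j} → SameKind (tail s i) (tail t j)
    hubs  : ∀ {i j} → SameKind (hub i) (hub j)
    lows  : ∀ {i j a b} → SameKind (low i a) (low j b)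
    highs : ∀ {i j p q} → SameKind (high i p) (high j q)

  tail≤2 : ∀ s j → valency (tail s j) ≤ 2
  tail≤2 s zero    = s≤s z≤n
  tail≤2 s (suc j) = s≤s (s≤s z≤n)

  high<low : suc m < m + m
  high<low = +-monoˡ-< m 1<m

  tail<high : ∀ s j → valency (tail s j) < suc m
  tail<high s j = s≤s (≤-trans (tail≤2 s j) 1<m)

  low<hub : m + m < 2 + (m + m)
  low<hub = s≤s (n≤1+n _)

  tail<low : ∀ s j → valency (tail s j) < m + m
  tail<low s j = <-trans (tail<high s j) high<low

  -- As m > 1, the valencies are separated: at most 2 on tails, then m + 1 < 2m < 2m + 2 for high,
  -- low and hub vertices.
  same-kind : ∀ u v → valency u ≡ valency v → SameKind u v
  same-kind (tail _ _) (tail _ _) e = tails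
  same-kind (tail s j) (hub _)    e = contradiction e (<⇒≢ (<-trans (tail<low s j) low<hub))
  same-kind (tail s j) (low _ _)  e = contradiction e (<⇒≢ (tail<low s j))
  same-kind (tail s j) (high _ _) e = contradiction e (<⇒≢ (tail<high s j))
  same-kind (hub _)    (tail s j) e = contradiction e (>⇒≢ (<-trans (tail<low s j) low<hub))
  same-kind (hub _)    (hub _)    e = hubs
  same-kind (hub _)    (low _ _)  e = contradiction e (>⇒≢ low<hub)
  same-kind (hub _)    (high _ _) e = contradiction e (>⇒≢ (<-trans high<low low<hub))
  same-kind (low _ _)  (tail s j) e = contradiction e (>⇒≢ (tail<low s j))
  same-kind (low _ _)  (hub _)    e = contradiction e (<⇒≢ low<hub)
  same-kind (low _ _)  (low _ _)  e = lows
  same-kind (low _ _)  (high _ _) e = contradiction e (>⇒≢ high<low)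
  same-kind (high _ _) (tail s j) e = contradiction e (>⇒≢ (tail<high s j))
  same-kind (high _ _) (hub _)    e = contradiction e (<⇒≢ (<-trans high<low low<hub))
  same-kind (high _ _) (low _ _)  e = contradiction e (<⇒≢ high<low)
  same-kind (high _ _) (high _ _) e = highs

  attached : ∀ s → valency (proj₁ (attachment s)) ≡ 2 + (m + m)
  attached false = refl
  attached true  = refl

  module _ (c : Code) where
    open Network (necklace c)

    -- One level suffices: the edges at the fixed hub ports m + 2 + d have the digits plus one as
    -- their far ports.
    hub-injective-view : ∀ l i i′ → view-of (suc l) (hub i) ≡ view-of (suc l) (hub i′) → i ≡ i′
    hub-injective-view l i i′ e = h-injective i i′ λ d →
      Fin.suc-injective (toℕ-injective (trans (sym (digit i d))
        (trans (proj₁ (view-step (necklace c) l (hub i) (hub i′) e _ _ refl)) (digit i′ d))))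
      where
      digit : ∀ i d → portℕ (opp (hub i , suc (suc (m ↑ʳ d)))) ≡ toℕ (Fin.suc (h i d))
      digit i d rewrite σ-digit c i d | label-digit i d = refl

    exit : ∀ i p → opp (high i p , suc (label i p)) ≡ (hub i , σ c (hub i) (suc (suc p)))
    exit i p = cong (λ q → twist c (opposite (high i p , q))) (swap₀-gate (label i p))

    high-exit : ∀ i p q → q ≡ suc (label i p) ⊎ valency (proj₁ (opp (high i p , q))) ≡ m + m
    high-exit i p q with swap₀ (label i p) q in eq
    ... | zero  = inj₁ (swap₀-injective (label i p) (trans eq (sym (swap₀-gate (label i p)))))
    ... | suc a = inj₂ refl

    -- The edge to the hub is recognised by the degree at its far end: all other neighbours are low,
    -- of valency 2m instead of 2m + 2. Hence equal views place it at the same port.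
    high-gate : ∀ l i i′ p p′ → view-of (suc l) (high i p) ≡ view-of (suc l) (high i′ p′) →
      label i p ≡ label i′ p′ × view-of l (hub i) ≡ view-of l (hub i′) ×
      toℕ (σ c (hub i) (suc (suc p))) ≡ toℕ (σ c (hub i′) (suc (suc p′)))
    high-gate l i i′ p p′ e with high-exit i′ p′ (suc (label i p))
    ... | inj₁ q≡ = Fin.suc-injective q≡ , subst₂ SameChild (exit i p) (exit i′ p′) gates
      where
      SameChild : Dart → Dart → Set
      SameChild d d′ = view-of l (proj₁ d) ≡ view-of l (proj₁ d′) × portℕ d ≡ portℕ d′
      gates : SameChild (opp (high i p , suc (label i p))) (opp (high i′ p′ , suc (label i′ p′)))
      gates = swap (view-step (necklace c) l (high i p) (high i′ p′) e _ _ (cong toℕ q≡))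
    ... | inj₂ is-low = contradiction
      (trans (sym is-low) (trans (sym (view-degree (necklace c) l _ _
        (proj₂ (view-step (necklace c) l (high i p) (high i′ p′) e (suc (label i p)) (suc (label i p)) refl))))
        (cong (valency ∘ proj₁) (exit i p))))
      (<⇒≢ low<hub)

    -- One level leads to the hub and a second reads its digits; the port at which the hub is
    -- entered then gives `p`.
    high-injective-view : ∀ l i i′ p p′ → view-of (suc (suc l)) (high i p) ≡ view-of (suc (suc l)) (high i′ p′) →
      _≡_ {A = Node} (high i p) (high i′ p′)
    high-injective-view l i i′ p p′ e with high-gate (suc l) i i′ p p′ e
    ... | _ , e₁ , e₂ with hub-injective-view l i i′ e₁
    ... | refl with σ-injective c (hub i) (toℕ-injective e₂)
    ... | refl = refl

    -- The labels of the digit vertices, visible two levels down, give `i`. The far port of the edge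
    -- to a vertex labelled `z` gives `a`, because the ports there are permuted by `swap₀ z` in
    -- every gadget.
    low-injective-view : ∀ l i i′ a a′ → view-of (suc (suc l)) (low i a) ≡ view-of (suc (suc l)) (low i′ a′) →
      _≡_ {A = Node} (low i a) (low i′ a′)
    low-injective-view l i i′ a a′ e = cong₂ low
      (h-injective i i′ λ d → trans (sym (label-digit i d))
        (trans (proj₁ (high-gate l i i′ _ _
          (proj₂ (view-step (necklace c) (suc l) (low i a) (low i′ a′) e (m ↑ʳ d) (m ↑ʳ d) refl)))) (label-digit i′ d)))
      (Fin.suc-injective (swap₀-injective z (toℕ-injective (trans (sym (anchor i a))
        (trans (proj₁ (view-step (necklace c) (suc l) (low i a) (low i′ a′) e (z ↑ˡ m) (z ↑ˡ m) refl)) (anchor i′ a′))))))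
      where
      anchor : ∀ i a → portℕ (opp (low i a , z ↑ˡ m)) ≡ toℕ (swap₀ z (suc a))
      anchor i a rewrite label-anchor i = refl

    -- Walking inward, the number of steps to the first hub gives the position in
    -- the tail, and the port at which that hub is entered gives the side.
    tail-injective-view : ∀ l s t i j → f ≤ l + toℕ i → f ≤ l + toℕ j →
      view-of (suc l) (tail s i) ≡ view-of (suc l) (tail t j) → _≡_ {A = Node} (tail s i) (tail t j)
    tail-injective-view l s t i j f≤i f≤j e with view-step (necklace c) l (tail s i) (tail t j) e zero zero refl
    ... | e₁ , e₂ with view i | view j
    tail-injective-view l false false _ _ _ _ e | _ | ‵fromℕ | ‵fromℕ = refl
    tail-injective-view l true true _ _ _ _ e | _ | ‵fromℕ | ‵fromℕ = refl
    tail-injective-view l false true _ _ _ _ e | e₁ , _ | ‵fromℕ | ‵fromℕ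
      = contradiction (trans e₁ (cong toℕ (σ-right c (fromℕ k)))) λ ()
    tail-injective-view l true false _ _ _ _ e | e₁ , _ | ‵fromℕ | ‵fromℕ
      = contradiction (trans (sym e₁) (cong toℕ (σ-right c (fromℕ k)))) λ ()
    tail-injective-view l s t _ _ _ _ e | _ , e₂ | ‵fromℕ | ‵inject₁ j
      = contradiction (trans (sym (attached s)) (view-degree (necklace c) l _ _ e₂)) (>⇒≢ (<-trans (tail<low t (suc j)) low<hub))
    tail-injective-view l s t _ _ _ _ e | _ , e₂ | ‵inject₁ i | ‵fromℕ
      = contradiction (trans (view-degree (necklace c) l _ _ e₂) (attached t)) (<⇒≢ (<-trans (tail<low s (suc i)) low<hub))
    tail-injective-view zero s t _ _ f≤i _ e | _ | ‵inject₁ i | ‵inject₁ j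
      = contradiction (≤-trans f≤i (≤-reflexive (toℕ-inject₁ i))) (<⇒≱ (toℕ<n i))
    tail-injective-view (suc l) s t _ _ f≤i f≤j e | _ , e₂ | ‵inject₁ i | ‵inject₁ j
      with tail-injective-view l s t _ _ (shift i f≤i) (shift j f≤j) e₂
      where
      shift : ∀ (i : Fin f) → f ≤ suc l + toℕ (inject₁ i) → f ≤ l + toℕ (Fin.suc i)
      shift i f≤ = ≤-trans f≤ (≤-reflexive (trans (cong (suc l +_) (toℕ-inject₁ i)) (sym (+-suc l (toℕ i)))))
    ... | refl = refl

    -- Low and high vertices take depth two, available since φ > 1; the free end of a tail takes
    -- depth `suc f` to see the port at the hub.
    views-distinct : ∀ u v → view-of (suc f) u ≡ view-of (suc f) v → u ≡ v
    views-distinct u v e with same-kind u v (view-degree (necklace c) (suc f) u v e)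
    ... | tails = tail-injective-view f _ _ _ _ (m≤m+n f _) (m≤m+n f _) e
    ... | hubs  = cong hub (hub-injective-view f _ _ e)
    ... | lows  = low-injective-view ψ _ _ _ _ e
    ... | highs = high-injective-view ψ _ _ _ _ e

  -- Views from the two tails

  module _ (c c′ : Code) (s t : Bool) where
    private
      module X = Network (necklace c)
      module Y = Network (necklace c′)

    -- A step inward keeps `l + toℕ j` constant and a step outward lowers it, so the hub is entered
    -- only with `l + f ≤ b` levels left. For b = f - 1 the hypothesis `end` is vacuous; for b = f
    -- it concerns only the entry port and the degree of the hub.
    tail-views : ∀ b → (∀ l → l + f ≤ b → X.branch l (twist c (attachment s)) ≡ Y.branch l (twist c′ (attachment t))) →
      ∀ l j → l + toℕ j ≤ suc b → X.view-of l (tail s j) ≡ Y.view-of l (tail t j)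
    tail-views b end zero    j l+j≤b = refl
    tail-views b end (suc l) j (s≤s l+j≤b) = cong node (map-cong (λ p → child j p l+j≤b) (allFin _))
      where
      child : ∀ j p → l + toℕ j ≤ b → X.branch l (X.opp (tail s j , p)) ≡ Y.branch l (Y.opp (tail t j , p))
      child j zero l+j≤b with view j
      ... | ‵fromℕ     = end l (subst (λ i → l + i ≤ b) (toℕ-fromℕ f) l+j≤b)
      ... | ‵inject₁ i = cong (1 ,_) (tail-views b end l (suc i)
              (subst (_≤ suc b) (sym (+-suc l (toℕ i))) (s≤s (subst (λ i → l + i ≤ b) (toℕ-inject₁ i) l+j≤b))))
      child (suc j) (suc zero) l+j≤b = cong (0 ,_) (tail-views b end l (inject₁ j)
              (≤-trans (+-monoʳ-≤ l (≤-trans (≤-reflexive (toℕ-inject₁ j)) (n≤1+n _))) (≤-trans l+j≤b (n≤1+n b))))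

  leaf-twins : ∀ c l → l < suc f → Network.view-of (necklace c) l (tail false zero) ≡ Network.view-of (necklace c) l (tail true zero)
  leaf-twins c l (s≤s l≤f) = tail-views c c false true ψ (λ l l+f≤ψ → contradiction l+f≤ψ (<⇒≱ (m≤n+m (suc ψ) l))) l zero
    (subst (_≤ f) (sym (+-identityʳ l)) l≤f)

  leaf-view-constant : ∀ c c′ s → Network.view-of (necklace c) (suc f) (tail s zero) ≡ Network.view-of (necklace c′) (suc f) (tail s zero)
  leaf-view-constant c c′ s = tail-views c c′ s s f end (suc f) zero (≤-reflexive (+-identityʳ (suc f)))
    where
    entry : ∀ s → Network.branch (necklace c) 0 (twist c (attachment s)) ≡ Network.branch (necklace c′) 0 (twist c′ (attachment s))
    -- Hub `zero` is not relabelled, and no code moves port 1 of the last hub.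
    entry false = refl
    entry true  = cong (λ p → toℕ p , leaf (2 + (m + m))) (trans (σ-right c (fromℕ k)) (sym (σ-right c′ (fromℕ k))))
    end : ∀ l → l + f ≤ f → _
    end zero    _ = entry s
    end (suc l) l+f<f = contradiction l+f<f (<⇒≱ (s≤s (m≤n+m f l)))

  -- Walks up to the first bridge on which two codes differ

  module Cut (c c′ : Code) (i₀ : Fin k) (agree : ∀ i → toℕ i < toℕ i₀ → c i ≡ c′ i) (differ : c i₀ ≢ c′ i₀) where
    private
      module X = Network (necklace c)
      module Y = Network (necklace c′)

    -- The component of the left tail once the bridge into hub `suc i₀`, whose entry port is set by
    -- the code at `i₀`, is removed.
    Before : Node → Set
    Before (tail false j) = ⊤
    Before (tail true j)  = ⊥
    Before (hub i)        = toℕ i ≤ toℕ i₀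
    Before (low i a)      = toℕ i ≤ toℕ i₀
    Before (high i p)     = toℕ i ≤ toℕ i₀

    σ-agrees : ∀ v → Before v → ∀ p → σ c v p ≡ σ c′ v p
    σ-agrees (tail s j)    _ p = refl
    σ-agrees (hub zero)    _ p = refl
    -- Hub `suc i` carries the code at `i`, so the weak bound `b` on `suc i` is the strict bound on
    -- `i` required by `agree`.
    σ-agrees (hub (suc i)) b p = cong (λ a → swap₀ (suc (a ↑ˡ m)) p) (agree i b)
    σ-agrees (low i a)     _ p = refl
    σ-agrees (high i b)    _ p = refl

    before-or-bridge : ∀ v p → Before v →
      Before (proj₁ (opposite (v , p))) ⊎ opposite (v , p) ≡ (hub (suc i₀) , zero)
    before-or-bridge (tail false j) zero b with view j
    ... | ‵fromℕ     = inj₁ z≤n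
    ... | ‵inject₁ i = inj₁ tt
    before-or-bridge (tail false (suc j)) (suc zero) b = inj₁ tt
    before-or-bridge (hub zero)    zero b = inj₁ tt
    before-or-bridge (hub (suc i)) zero b = inj₁ (≤-trans (≤-reflexive (toℕ-inject₁ i)) (<⇒≤ b))
    before-or-bridge (hub i) (suc zero) b with view i
    ... | ‵fromℕ     = contradiction (subst (_≤ toℕ i₀) (toℕ-fromℕ k) b) (<⇒≱ (toℕ<n i₀))
    ... | ‵inject₁ j with m≤n⇒m<n∨m≡n (subst (_≤ toℕ i₀) (toℕ-inject₁ j) b)
    ...   | inj₁ j<i₀ = inj₁ j<i₀
    ...   | inj₂ j≡i₀ = inj₂ (cong (λ i → hub (suc i) , zero) (toℕ-injective j≡i₀))
    before-or-bridge (hub i)    (suc (suc p)) b = inj₁ b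
    before-or-bridge (low i a)  p             b = inj₁ b
    before-or-bridge (high i p) zero          b = inj₁ b
    before-or-bridge (high i p) (suc a)       b = inj₁ b

    -- Crossing the bridge would show far port `c i₀` + 2 in one necklace and `c′ i₀` + 2 in the
    -- other, so equal far ports exclude it.
    step-agrees : ∀ v p → Before v → X.portℕ (X.opp (v , p)) ≡ Y.portℕ (Y.opp (v , p)) →
      proj₁ (X.opp (v , p)) ≡ proj₁ (Y.opp (v , p)) × Before (proj₁ (X.opp (v , p)))
    step-agrees v p b e rewrite σ-agrees v b p with before-or-bridge v (σ c′ v p) b
    ... | inj₁ b′ = refl , b′
    ... | inj₂ bridge rewrite bridge = contradiction (Fin.↑ˡ-injective m _ _ (toℕ-injective (suc-injective (suc-injective e)))) differ

    -- Matching two walks over one sequence directly would require unifying `toℕ p` with `toℕ p′`;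
    -- here the equation is returned instead.
    uncons : ∀ (Z : Network Node) {v q ps w} → Network.Walk Z v (q ∷ ps) w →
      Σ (Fin (Network.degree Z v)) λ p → q ≡ (toℕ p , Network.portℕ Z (Network.opp Z (v , p))) ×
        Network.Walk Z (proj₁ (Network.opp Z (v , p))) ps w
    uncons Z (Network.go p W) = p , refl , W

    walks-agree : ∀ ps {v w w′} → Before v → X.Walk v ps w → Y.Walk v ps w′ → w ≡ w′ × Before w
    walks-agree []       b X.stop Y.stop = refl , b
    walks-agree (_ ∷ ps) {v} {w′ = w′} b W W′ with uncons (necklace c) W | uncons (necklace c′) W′
    ... | p , e , V | p′ , e′ , V′ with toℕ-injective (cong proj₁ (trans (sym e) e′))
    ... | refl with step-agrees v p b (cong proj₂ (trans (sym e) e′))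
    ... | u≡u′ , b′ = walks-agree ps b′ V (subst (λ u → Y.Walk u ps w′) (sym u≡u′) V′)

    no-common-leader : ∀ {w w′ ps qs} →
      X.Walk (tail false zero) ps w → X.Walk (tail true zero) qs w →
      Y.Walk (tail false zero) ps w′ → Y.Walk (tail true zero) qs w′ → ⊥
    no-common-leader P Q P′ Q′ with walks-agree _ tt P P′
    -- The reversed walk ends at the right tail, where `Before` is empty.
    ... | refl , b = proj₂ (walks-agree _ b (back-walk (necklace c) Q) (back-walk (necklace c′) Q′))

-- Counting advice strings

-- Numeration in base two with digits 1 and 2: without a digit zero, strings of different lengths
-- also get different values.
bijective-binary : List Bool → ℕᵇ
bijective-binary []          = ℕᵇ.zero
bijective-binary (false ∷ s) = 1+[2 bijective-binary s ]
bijective-binary (true ∷ s)  = 2[1+ bijective-binary s ]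

bijective-binary-injective : ∀ s t → bijective-binary s ≡ bijective-binary t → s ≡ t
bijective-binary-injective []          []          e = refl
bijective-binary-injective []          (false ∷ t) ()
bijective-binary-injective []          (true ∷ t)  ()
bijective-binary-injective (false ∷ s) []          ()
bijective-binary-injective (false ∷ s) (true ∷ t)  ()
bijective-binary-injective (true ∷ s)  []          ()
bijective-binary-injective (true ∷ s)  (false ∷ t) ()
bijective-binary-injective (false ∷ s) (false ∷ t) e = cong (false ∷_) (bijective-binary-injective s t (ℕᵇ.1+[2_]-injective e))
bijective-binary-injective (true ∷ s)  (true ∷ t)  e = cong (true ∷_) (bijective-binary-injective s t (ℕᵇ.2[1+_]-injective e))

-- Equality holds for strings consisting of `true` only.
bijective-binary-bound : ∀ s → 2 + ℕᵇ.toℕ (bijective-binary s) ≤ 2 ^ suc (length s)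
bijective-binary-bound []          = ≤-refl
bijective-binary-bound (false ∷ s) = begin
  3 + 2 * ℕᵇ.toℕ (bijective-binary s)   ≤⟨ n≤1+n _ ⟩
  4 + 2 * ℕᵇ.toℕ (bijective-binary s)   ≡⟨ *-distribˡ-+ 2 2 (ℕᵇ.toℕ (bijective-binary s)) ⟨
  2 * (2 + ℕᵇ.toℕ (bijective-binary s)) ≤⟨ *-monoʳ-≤ 2 (bijective-binary-bound s) ⟩
  2 * 2 ^ suc (length s)                ∎
  where open ≤-Reasoning
bijective-binary-bound (true ∷ s)  = begin
  2 + 2 * suc (ℕᵇ.toℕ (bijective-binary s)) ≡⟨ *-distribˡ-+ 2 1 (suc (ℕᵇ.toℕ (bijective-binary s))) ⟨
  2 * (2 + ℕᵇ.toℕ (bijective-binary s))     ≤⟨ *-monoʳ-≤ 2 (bijective-binary-bound s) ⟩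
  2 * 2 ^ suc (length s)                    ∎
  where open ≤-Reasoning

short-strings-collide : ∀ T {n} → 2 ^ T ≤ n → (s : Fin n → List Bool) → (∀ i → length (s i) < T) →
  ∃₂ λ i j → i ≢ j × s i ≡ s j
short-strings-collide T {n} 2^T≤n s short with Fin.pigeonhole few (λ i → fromℕ< (bound i))
  where
  -- Strings shorter than T take at most 2 ^ T - 1 values, the empty string included.
  few : pred (2 ^ T) < n
  few = ≤-trans (≤-reflexive (suc-pred (2 ^ T) {{m^n≢0 2 T}})) 2^T≤n
  bound : ∀ i → ℕᵇ.toℕ (bijective-binary (s i)) < pred (2 ^ T)
  bound i = pred-mono-≤ (≤-trans (bijective-binary-bound (s i)) (^-monoʳ-≤ 2 (short i)))
... | i , j , i<j , e = i , j , (λ i≡j → <-irrefl (cong toℕ i≡j) i<j) ,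
  bijective-binary-injective _ _ (ℕᵇ.toℕ-injective (Fin.fromℕ<-injective _ _ _ _ e))

funToFin-cong : ∀ {m n} {f g : Fin m → Fin n} → (∀ i → f i ≡ g i) → funToFin f ≡ funToFin g
funToFin-cong {zero}  e = refl
funToFin-cong {suc m} e = cong₂ combine (e zero) (funToFin-cong (e ∘ suc))

-- `funToFin` is a left inverse, and `funToFin-cong` replaces function extensionality.
finToFun-injective : ∀ {m n} (i j : Fin (m ^ n)) → (∀ d → finToFun {m} {n} i d ≡ finToFun j d) → i ≡ j
finToFun-injective {m} {n} i j e = trans (sym (Fin.funToFin-finToFin {n} {m} i)) (trans (funToFin-cong e) (Fin.funToFin-finToFin {n} {m} j))

-- The family of necklaces and the advice it requires

module Election (ψ k m : ℕ) (1<m : 1 < m) (z : Fin m) (h : Fin (suc k) → Fin m → Fin m)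
                (h-injective : ∀ i i′ → (∀ d → h i d ≡ h i′ d) → i ≡ i′)
                (size : ℕ) (iso : Fin size ↔ Skeleton.Node (suc ψ) k m (m + m)) where
  open Necklace ψ k m 1<m z h h-injective

  open Inverse iso using (to; from; strictlyInverseˡ)

  graph : Code → PortGraph size
  graph c = portGraph iso (necklace c)

  graph-connected : ∀ c → Connected (graph c)
  graph-connected c u v = star-reachable iso (necklace c) (gmap id (λ {v} → necklace-adjacent c {v}) (connected (z ↑ˡ m) (to u) (to v)))

  graph-distinct : ∀ c → DistinctB (graph c) (suc f)
  graph-distinct c u v e = to-injective iso (necklace c) {u} {v} (views-distinct c (to u) (to v)
    (trans (sym (B-view iso (necklace c) (suc f) u)) (trans e (B-view iso (necklace c) (suc f) v))))

  B-from : ∀ c l v → B (graph c) l (from v) ≡ Network.view-of (necklace c) l v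
  B-from c l v = trans (B-view iso (necklace c) l (from v)) (cong (Network.view-of (necklace c) l) (strictlyInverseˡ v))

  graph-index : ∀ c → ElectionIndex (graph c) (suc f)
  graph-index c = graph-distinct c , λ l l<φ d → contradiction
    (from-injective iso (necklace c) {tail false zero} {tail true zero} (d (from (tail false zero)) (from (tail true zero))
      (trans (B-from c l _) (trans (leaf-twins c l l<φ) (sym (B-from c l _)))))) λ ()

  elects-walks : ∀ c (out : Tree → List (ℕ × ℕ)) → Elects (graph c) (λ v → out (B (graph c) (suc f) v)) →
    ∃ λ w → ∀ s → Network.Walk (necklace c) (tail s zero) (out (Network.view-of (necklace c) (suc f) (tail s zero))) w
  elects-walks c out (w , paths) = to w , λ s →
    subst₂ (λ v t → Network.Walk (necklace c) v (out t) (to w)) (strictlyInverseˡ (tail s zero)) (B-from c (suc f) (tail s zero))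
      (path-walk iso (necklace c) (proj₁ (proj₂ (paths (from (tail s zero))))))

  -- Well-founded induction supplies agreement at all earlier indices, so an index of disagreement
  -- is the first one, as `Cut` demands.
  same-output⇒same-code : ∀ c c′ (out : Tree → List (ℕ × ℕ)) →
    Elects (graph c)  (λ v → out (B (graph c)  (suc f) v)) →
    Elects (graph c′) (λ v → out (B (graph c′) (suc f) v)) → ∀ i → c i ≡ c′ i
  same-output⇒same-code c c′ out E E′ = WellFounded.All.wfRec Fin.<-wellFounded _ _ agree
    where
    agree : ∀ i → (∀ {j} → toℕ j < toℕ i → c j ≡ c′ j) → c i ≡ c′ i
    agree i earlier with c i Fin.≟ c′ i
    ... | yes e = e
    ... | no differ with elects-walks c out E | elects-walks c′ out E′
    ... | w , P | w′ , P′ = contradiction (Cut.no-common-leader c c′ i (λ j → earlier) differ (P false) (P true) (same false) (same true)) λ ()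
      where
      same : ∀ s → Network.Walk (necklace c′) (tail s zero) (out (Network.view-of (necklace c) (suc f) (tail s zero))) w′
      -- The free ends have the same view at depth φ in both necklaces, hence the same output.
      same s = subst (λ t → Network.Walk (necklace c′) (tail s zero) (out t) w′) (leaf-view-constant c′ c s) (P′ s)

  member : Fin (m ^ k) → PortGraph size
  member x = graph (finToFun x)

  family : List (PortGraph size)
  family = map member (allFin (m ^ k))

  ∈-family : ∀ x → member x ∈ family
  ∈-family x = ∈-map⁺ member (∈-allFin x)

  family-members : All (λ G → Connected G × Feasible G × ElectionIndex G (suc f)) family
  family-members = All.map⁺ (All.universal (λ x → graph-connected (finToFun x) ,
    feasible (member x) (suc f) (graph-distinct (finToFun x)) , graph-index (finToFun x)) (allFin (m ^ k)))

  -- Decidability of `Long` makes the argument constructive: either a search of the family finds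
  -- long advice, or all advice is shorter than T and two codes share a string.
  some-advice-long : ∀ T → 2 ^ T ≤ m ^ k → (Long : ℕ → Set) → (∀ l → Dec (Long l)) → (∀ l → T ≤ l → Long l) →
    (O : PortGraph size → List Bool) (A : List Bool → Tree → List (ℕ × ℕ)) →
    All (λ G → Elects G (λ v → A (O G) (B G (suc f) v))) family → Any (λ G → Long (length (O G))) family
  some-advice-long T 2^T≤ Long Long? long O A elects with any? (λ G → Long? (length (O G))) family
  ... | yes found = found
  ... | no  none  with short-strings-collide T 2^T≤ (O ∘ member) (λ x → ≰⇒> (none ∘ lose (∈-family x) ∘ long _))
  ... | x , y , x≢y , Ox≡Oy = contradiction (finToFun-injective {m} {k} x y
    (same-output⇒same-code (finToFun x) (finToFun y) (A (O (member x))) (run x)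
      (subst (λ s → Elects (member y) (λ v → A s (B (member y) (suc f) v))) (sym Ox≡Oy) (run y)))) x≢y
    where
    run : ∀ x → Elects (member x) (λ v → A (O (member x)) (B (member x) (suc f) v))
    run x = All.lookup elects (∈-family x)

-- Estimates of n, log n and log log n

module Arithmetic (φ e k m n : ℕ) (m≡ : m ≡ 2 ^ e) (n≡ : n ≡ 2 * φ + suc k * (1 + (m + (m + m))))
   (φ≤e : φ ≤ e) (2≤e : 2 ≤ e) (k+1≡ : suc k ≡ m ^ m) where
  private
    P = suc k

  P≡ : P ≡ 2 ^ (e * m)
  P≡ = trans k+1≡ (trans (cong (_^ m) m≡) (^-*-assoc 2 e m))

  e≤m : e ≤ m
  e≤m = ≤-trans (<⇒≤ (n<2^n e)) (≤-reflexive (sym m≡))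
    where
    n<2^n : ∀ a → a < 2 ^ a
    n<2^n zero    = s≤s z≤n
    n<2^n (suc a) = ≤-trans (+-mono-≤ (m^n>0 2 a) (n<2^n a)) (≤-reflexive (cong (2 ^ a +_) (sym (+-identityʳ _))))

  4≤m : 4 ≤ m
  4≤m = ≤-trans (^-monoʳ-≤ 2 2≤e) (≤-reflexive (sym m≡))

  m≤n : m ≤ n
  m≤n = begin
    m                           ≤⟨ m≤n+m m (1 + m) ⟩
    1 + m + m                   ≤⟨ +-monoʳ-≤ (1 + m) (m≤m+n m m) ⟩
    1 + (m + (m + m))           ≤⟨ m≤m+n _ _ ⟩
    P * (1 + (m + (m + m)))     ≤⟨ m≤n+m _ (2 * φ) ⟩
    2 * φ + P * (1 + (m + (m + m))) ≡⟨ n≡ ⟨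
    n                           ∎
    where open ≤-Reasoning

  P≤n : P ≤ n
  P≤n = begin
    P                           ≤⟨ m≤m*n P (1 + (m + (m + m))) ⟩
    P * (1 + (m + (m + m)))     ≤⟨ m≤n+m _ (2 * φ) ⟩
    2 * φ + P * (1 + (m + (m + m))) ≡⟨ n≡ ⟨
    n                           ∎
    where open ≤-Reasoning

  n≤8mP : n ≤ 8 * m * P
  n≤8mP = begin
    n                                     ≡⟨ n≡ ⟩
    2 * φ + P * (1 + (m + (m + m)))       ≤⟨ +-mono-≤ (*-monoʳ-≤ 2 (≤-trans φ≤e e≤m)) (*-monoʳ-≤ P (+-monoˡ-≤ (m + (m + m)) (≤-trans (s≤s z≤n) 4≤m))) ⟩
    2 * m + P * (m + (m + (m + m)))       ≤⟨ +-monoˡ-≤ _ (m≤m*n (2 * m) P) ⟩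
    -- Extra slack raises the coefficient from 6 to 8, so that the bound is a power of two with an
    -- exact logarithm.
    2 * m * P + P * (m + (m + (m + m)))   ≤⟨ m≤m+n _ (2 * m * P) ⟩
    2 * m * P + P * (m + (m + (m + m))) + 2 * m * P ≡⟨ collect m P ⟩
    8 * m * P                             ∎
    where
    open ≤-Reasoning
    collect : ∀ m P → 2 * m * P + P * (m + (m + (m + m))) + 2 * m * P ≡ 8 * m * P
    collect = solve-∀

  em≤log : e * m ≤ ⌊log₂ n ⌋
  em≤log = subst (_≤ ⌊log₂ n ⌋) (trans (cong ⌊log₂_⌋ P≡) (⌊log₂[2^n]⌋≡n (e * m))) (⌊log₂⌋-mono-≤ P≤n)

  -- The bound is m ^ 3, written as a power of two for the second logarithm.
  log≤ : ⌊log₂ n ⌋ ≤ 2 ^ (3 * e)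
  log≤ = begin
    ⌊log₂ n ⌋                     ≤⟨ ⌊log₂⌋-mono-≤ (≤-trans n≤8mP (≤-reflexive 8mP≡)) ⟩
    ⌊log₂ 2 ^ (3 + e + e * m) ⌋   ≡⟨ ⌊log₂[2^n]⌋≡n (3 + e + e * m) ⟩
    3 + e + e * m                 ≤⟨ +-mono-≤ (+-mono-≤ (≤-trans (n≤1+n 3) 4≤m) e≤m) (*-monoˡ-≤ m e≤m) ⟩
    m + m + m * m                 ≤⟨ +-monoˡ-≤ (m * m) (+-mono-≤ m≤m*m m≤m*m) ⟩
    m * m + m * m + m * m         ≤⟨ m≤n+m _ (m * m) ⟩
    m * m + (m * m + m * m + m * m) ≡⟨ collect m ⟩
    4 * (m * m)                   ≤⟨ *-monoˡ-≤ (m * m) 4≤m ⟩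
    m * (m * m)                   ≡⟨ cong (λ x → m * (m * x)) (*-identityʳ m) ⟨
    m ^ 3                         ≡⟨ trans (trans (cong (_^ 3) m≡) (^-*-assoc 2 e 3)) (cong (2 ^_) (*-comm e 3)) ⟩
    2 ^ (3 * e)                   ∎
    where
    open ≤-Reasoning
    8mP≡ : 8 * m * P ≡ 2 ^ (3 + e + e * m)
    8mP≡ = trans (cong₂ _*_ (trans (cong (8 *_) m≡) (sym (^-distribˡ-+-* 2 3 e))) P≡) (sym (^-distribˡ-+-* 2 (3 + e) (e * m)))
    m≤m*m : m ≤ m * m
    m≤m*m = m≤m*n m m {{>-nonZero (≤-trans (s≤s z≤n) 4≤m)}}
    collect : ∀ m → m * m + (m * m + m * m + m * m) ≡ 4 * (m * m)
    collect = solve-∀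

  loglog≤ : ⌊log₂ ⌊log₂ n ⌋ ⌋ ≤ 3 * e
  loglog≤ = ≤-trans (⌊log₂⌋-mono-≤ log≤) (≤-reflexive (⌊log₂[2^n]⌋≡n (3 * e)))

  1≤k : 1 ≤ k
  1≤k = s≤s⁻¹ (begin
    2            ≤⟨ ^-monoʳ-≤ 2 {1} (*-mono-≤ (≤-trans (s≤s z≤n) 2≤e) (≤-trans (s≤s z≤n) 4≤m)) ⟩
    2 ^ (e * m)  ≡⟨ P≡ ⟨
    suc k        ∎)
    where open ≤-Reasoning

  -- With K = `suc k`, the estimates n ≤ 8mK, log log n ≤ 3e and log n ≥ em reduce the claim to 72
  -- eK ≤ 144 ek, which holds as K ≤ 2k.
  advice-bound : ∀ len → e * k ≤ len → 1 * n * (⌊log₂ ⌊log₂ n ⌋ ⌋ ^ 2) ≤ 144 * len * ⌊log₂ n ⌋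
  advice-bound len ek≤len = begin
    1 * n * (⌊log₂ ⌊log₂ n ⌋ ⌋ ^ 2)     ≤⟨ *-mono-≤ (≤-trans (≤-reflexive (*-identityˡ n)) n≤8mP) (^-monoˡ-≤ 2 loglog≤) ⟩
    8 * m * suc k * (3 * e) ^ 2         ≤⟨ *-monoˡ-≤ ((3 * e) ^ 2) (*-monoʳ-≤ (8 * m) (+-monoˡ-≤ k 1≤k)) ⟩
    8 * m * (k + k) * (3 * e) ^ 2       ≡⟨ collect m k e ⟩
    144 * (e * k) * (e * m)             ≤⟨ *-mono-≤ (*-monoʳ-≤ 144 ek≤len) em≤log ⟩
    144 * len * ⌊log₂ n ⌋               ∎
    where
    open ≤-Reasoning
    collect : ∀ m k e → 8 * m * (k + k) * (3 * e * (3 * e * 1)) ≡ 144 * (e * k) * (e * m)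
    collect = solve-∀

-- Hard families of arbitrarily large order

HardFamily : ℕ → ℕ → Set
HardFamily φ n = Σ (List (PortGraph n)) λ fam →
  All (λ G → Connected G × Feasible G × ElectionIndex G φ) fam ×
  ((O : PortGraph n → List Bool) → (A : List Bool → Tree → List (ℕ × ℕ)) →
  All (λ G → Elects G (λ v → A (O G) (B G φ v))) fam →
  Any (λ G → 1 * n * (⌊log₂ ⌊log₂ n ⌋ ⌋ ^ 2) ≤ 144 * length (O G) * ⌊log₂ n ⌋) fam)

-- The bound on `e` serves twice: it gives φ ≤ e for the estimates, and M ≤ e ≤ m ≤ n for the size.
hard-family : ∀ ψ M e m k → M + (2 + ψ) ≤ e → m ≡ 2 ^ e → suc k ≡ m ^ m →
  Σ ℕ λ n → M ≤ n × 0 < n × HardFamily (2 + ψ) n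
hard-family ψ M e m k M+φ≤e m≡ k+1≡ =
  Skeleton.order (suc ψ) k m (m + m) , ≤-trans (m+n≤o⇒m≤o M M+φ≤e) (≤-trans e≤m m≤n) , ≤-trans (s≤s z≤n) (≤-trans 4≤m m≤n) ,
  family , family-members ,
  -- There are m ^ k = 2 ^ (e * k) codes, whence the threshold `e * k`.
  some-advice-long (e * k) (≤-reflexive (sym (trans (cong (_^ k) m≡) (^-*-assoc 2 e k))))
    _ (λ _ → _ ≤? _) advice-bound
  where
  φ≤e : 2 + ψ ≤ e
  φ≤e = m+n≤o⇒n≤o M M+φ≤e
  open Arithmetic (2 + ψ) e k m (Skeleton.order (suc ψ) k m (m + m)) m≡ refl φ≤e (≤-trans (s≤s (s≤s z≤n)) φ≤e) k+1≡
  h : Fin (suc k) → Fin m → Fin m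
  h i = finToFun (cast k+1≡ i)
  h-injective : ∀ i i′ → (∀ d → h i d ≡ h i′ d) → i ≡ i′
  h-injective i i′ eq = Fin.toℕ-injective (trans (sym (Fin.toℕ-cast k+1≡ i))
    (trans (cong toℕ (finToFun-injective {m} {m} _ _ eq)) (Fin.toℕ-cast k+1≡ i′)))
  open Election ψ k m (≤-trans (s≤s (s≤s z≤n)) 4≤m) (fromℕ< (≤-trans (s≤s z≤n) 4≤m)) h h-injective
    (Skeleton.order (suc ψ) k m (m + m)) (Skeleton.node↔ (suc ψ) k m (m + m))

-- The constant κ is a / b, with denominators cleared; the set of orders is infinite because `n` can
-- be taken above any bound.
theorem3 : (φ : ℕ) → 1 < φ →
    Σ ℕ λ a → Σ ℕ λ b → 0 < a × 0 < b ×
    ((m : ℕ) → Σ ℕ λ n → m ≤ n × 0 < n ×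
    Σ (List (PortGraph n)) λ fam →
    All (λ G → Connected G × Feasible G × ElectionIndex G φ) fam ×
    ((O : PortGraph n → List Bool) → (A : List Bool → Tree → List (ℕ × ℕ)) →
    All (λ G → Elects G (λ v → A (O G) (B G φ v))) fam →
    Any (λ G → a * n * (⌊log₂ ⌊log₂ n ⌋ ⌋ ^ 2) ≤ b * length (O G) * ⌊log₂ n ⌋) fam))
theorem3 (suc (suc ψ)) (s≤s (s≤s z≤n)) = 1 , 144 , s≤s z≤n , s≤s z≤n , λ M →
  -- The base is a power of two, so log m = M + φ is exact; adding M forces the order above M.
  let m = 2 ^ (M + (2 + ψ)) in
  hard-family ψ M (M + (2 + ψ)) m (pred (m ^ m)) ≤-refl refl (suc-pred (m ^ m) {{m^n≢0 m m {{m^n≢0 2 (M + (2 + ψ))}}}})
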